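{- Let $A$ be a nonzero commutative ring, $k\ge1$, and suppose the shape $\vec s=(n_1,\dots,n_k)$ is constant, $n_a=n+1$ for all $a$ (where $n\ge 0$), so that $M_a(p)=p$ for all $a$, i.e. $I_p=[p]^k$. For $X_\bullet=X_\bullet(\vec s;A)$ the diagonal simplicial tensor module, the ranks of the components of the Moore complex in degree $p\ge0$ are $$\operatorname{rank}Z_p(N_\bullet)=(p+1)!\,S(k,p+1),\qquad \operatorname{rank}N_p(X)=p!\,S(k,p)+(p+1)!\,S(k,p+1),$$ where $S(k,m)$ denotes the Stirling number of the second kind.
   Context: $[p]=\{0,\dots,p\}$. In the constant shape case the diagonal simplicial tensor module is the simplicial $A$-module with $X_p=A^{[p]^k}$ (all functions $T:[p]^k\to A$), in which a nondecreasing map $\alpha:[p]\to[q]$ acts by $X_q\to X_p$, $T\mapsto T\circ(\alpha\times\cdots\times\alpha)$; in particular the face $d_i:X_p\to X_{p-1}$ is precomposition with the $k$-fold product of the increasing injection $[p-1]\to[p]$ missing $i$. The normalized (Moore) complex is $N_p(X)=\bigcap_{i=1}^p\ker(d_i:X_p\to X_{p-1})$ (with $N_0=X_0$) with differential $d_0:N_p\to N_{p-1}$, and $Z_p(N_\bullet)=\ker(d_0:N_p\to N_{p-1})$, which equals $\bigcap_{i=0}^p\ker d_i$ for $p\ge1$; in degree $0$ one has $X_{ -1}=0$, so $Z_0(N_\bullet)=X_0$. -}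

module Defs where

open import Algebra.Bundles using (CommutativeRing)
open import Algebra.Module.Bundles using (Module)
import Algebra.Module.Construct.TensorUnit as TensorUnit
import Algebra.Module.Construct.Zero as Zero
open import Algebra.Module.Morphism.Structures using (IsModuleHomomorphism)
open import Algebra.Module.Structures.Biased using (IsModuleFromLeft)
import Algebra.Properties.Group as GroupProperties
import Algebra.Properties.Monoid.Sum as MonoidSum
open import Data.Fin.Base using (Fin; zero; suc; punchIn)
open import Data.Fin.Properties using (≤-poset; punchIn-mono-≤)
open import Data.Nat.Base using (ℕ; zero; suc; pred; _+_; _*_)
open import Data.Product.Base using (Σ-syntax; ∃-syntax; _,_; proj₁; proj₂)
open import Data.Vec.Base using (Vec; lookup; map)
open import Data.Vec.Functional using (Vector)
open import Data.Vec.Properties using (map-id; map-cong; map-∘)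
open import Function.Base using (_∘_)
open import Level using (Level; _⊔_) renaming (suc to lsuc)
open import Relation.Binary.Morphism.Bundles using (PosetHomomorphism; mkPosetHomo)
open import Relation.Binary.Morphism.Construct.Composition
  using () renaming (posetHomomorphism to compose)
open import Relation.Binary.Morphism.Construct.Identity
  using () renaming (posetHomomorphism to identity)
open import Relation.Binary.PropositionalEquality as ≡ using (_≡_; _≗_)
import Relation.Binary.Reasoning.Setoid as SetoidReasoning
open import Relation.Nullary.Negation using (¬_)
open import Relation.Unary using (Pred)

private
  variable
    c ℓ m₁ ℓ₁ m₂ ℓ₂ i p : Level

------------------------------------------------------------------------
-- Stirling numbers of the second kind

-- A partition of a (k+1)-set into m+1 blocks either has the last element as
-- a singleton block, or arises by adding it to one of the m+1 blocks of a
-- partition of the remaining k elements.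
S : ℕ → ℕ → ℕ
S zero    zero    = 1
S zero    (suc m) = 0
S (suc k) zero    = 0
S (suc k) (suc m) = S k m + suc m * S k (suc m)

------------------------------------------------------------------------
-- Linear algebra over a commutative ring

Nonzero : CommutativeRing c ℓ → Set ℓ
Nonzero A = ¬ (1# ≈ 0#)
  where open CommutativeRing A

module _ {A : CommutativeRing c ℓ} where

  open CommutativeRing A using (0#; _≈_) renaming (Carrier to K)

  record LinearMap (M : Module A m₁ ℓ₁) (N : Module A m₂ ℓ₂)
                   : Set (c ⊔ m₁ ⊔ ℓ₁ ⊔ m₂ ⊔ ℓ₂) where
    private
      module M = Module M
      module N = Module N
    field
      ⟦_⟧                  : M.Carrierᴹ → N.Carrierᴹ
      isModuleHomomorphism : IsModuleHomomorphism M.rawModule N.rawModule ⟦_⟧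

    open IsModuleHomomorphism isModuleHomomorphism public

  -- The remaining preservation laws follow from these three.
  module _ (M : Module A m₁ ℓ₁) (N : Module A m₂ ℓ₂) where
    private
      module M = Module M
      module N = Module N

    mkLinearMap : (f : M.Carrierᴹ → N.Carrierᴹ) →
                  (∀ {x y} → x M.≈ᴹ y → f x N.≈ᴹ f y) →
                  (∀ x y → f (x M.+ᴹ y) N.≈ᴹ f x N.+ᴹ f y) →
                  (∀ a x → f (a M.*ₗ x) N.≈ᴹ a N.*ₗ f x) →
                  LinearMap M N
    mkLinearMap f f-cong f-+ f-* = record
      { ⟦_⟧                  = f
      ; isModuleHomomorphism = record
        { isBimoduleHomomorphism = record
          { +ᴹ-isGroupHomomorphism = record
            { isMonoidHomomorphism = record
              { isMagmaHomomorphism = record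
                { isRelHomomorphism = record { cong = f-cong }
                ; homo              = f-+
                }
              ; ε-homo = f-0
              }
            ; ⁻¹-homo = λ x →
                GroupProperties.inverseˡ-unique N.+ᴹ-group (f (M.-ᴹ x)) (f x)
                  (begin
                    f (M.-ᴹ x) N.+ᴹ f x  ≈⟨ f-+ (M.-ᴹ x) x ⟨
                    f (M.-ᴹ x M.+ᴹ x)    ≈⟨ f-cong (M.-ᴹ‿inverseˡ x) ⟩
                    f M.0ᴹ               ≈⟨ f-0 ⟩
                    N.0ᴹ                 ∎)
            }
          ; *ₗ-homo = f-*
          ; *ᵣ-homo = λ a x → begin
              f (x M.*ᵣ a)  ≈⟨ f-cong (M.*ₗ-*ᵣ-coincident a x) ⟨
              f (a M.*ₗ x)  ≈⟨ f-* a x ⟩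
              a N.*ₗ f x    ≈⟨ N.*ₗ-*ᵣ-coincident a (f x) ⟩
              f x N.*ᵣ a    ∎
          }
        }
      }
      where
      open SetoidReasoning N.≈ᴹ-setoid
      f-0 : f M.0ᴹ N.≈ᴹ N.0ᴹ
      f-0 = begin
        f M.0ᴹ              ≈⟨ f-cong (M.*ₗ-zeroˡ M.0ᴹ) ⟨
        f (0# M.*ₗ M.0ᴹ)    ≈⟨ f-* 0# M.0ᴹ ⟩
        0# N.*ₗ f M.0ᴹ      ≈⟨ N.*ₗ-zeroˡ (f M.0ᴹ) ⟩
        N.0ᴹ                ∎

    zeroMap : LinearMap M N
    zeroMap = mkLinearMap (λ _ → N.0ᴹ) (λ _ → N.≈ᴹ-refl)
      (λ _ _ → N.≈ᴹ-sym (N.+ᴹ-identityˡ N.0ᴹ)) (λ a _ → N.≈ᴹ-sym (N.*ₗ-zeroʳ a))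

  record Submodule (M : Module A m₁ ℓ₁) p : Set (c ⊔ m₁ ⊔ ℓ₁ ⊔ lsuc p) where
    open Module M
    field
      Member     : Pred Carrierᴹ p
      resp       : ∀ {x y} → x ≈ᴹ y → Member x → Member y
      0-closed   : Member 0ᴹ
      +-closed   : ∀ {x y} → Member x → Member y → Member (x +ᴹ y)
      neg-closed : ∀ {x} → Member x → Member (-ᴹ x)
      *-closed   : ∀ a {x} → Member x → Member (a *ₗ x)

  ⌊_⌋ : {M : Module A m₁ ℓ₁} → Submodule M p → Module A (m₁ ⊔ p) ℓ₁
  ⌊_⌋ {M = M} U = record
    { Carrierᴹ = Σ[ x ∈ Carrierᴹ ] Member x
    ; _≈ᴹ_     = λ x y → proj₁ x ≈ᴹ proj₁ y
    ; _+ᴹ_     = λ (x , x∈) (y , y∈) → x +ᴹ y , +-closed x∈ y∈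
    ; _*ₗ_     = λ a (x , x∈) → a *ₗ x , *-closed a x∈
    ; _*ᵣ_     = λ (x , x∈) a → a *ₗ x , *-closed a x∈
    ; 0ᴹ       = 0ᴹ , 0-closed
    ; -ᴹ_      = λ (x , x∈) → -ᴹ x , neg-closed x∈
    ; isModule = IsModuleFromLeft.isModule {commutativeRing = A} record
      { isLeftModule = record
        { isLeftSemimodule = record
          { +ᴹ-isCommutativeMonoid = record
            { isMonoid = record
              { isSemigroup = record
                { isMagma = record
                  { isEquivalence = record
                    { refl = ≈ᴹ-refl ; sym = ≈ᴹ-sym ; trans = ≈ᴹ-trans }
                  ; ∙-cong = +ᴹ-cong
                  }
                ; assoc = λ x y z → +ᴹ-assoc (proj₁ x) (proj₁ y) (proj₁ z)
                }
              ; identity = +ᴹ-identityˡ ∘ proj₁ , +ᴹ-identityʳ ∘ proj₁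
              }
            ; comm = λ x y → +ᴹ-comm (proj₁ x) (proj₁ y)
            }
          ; isPreleftSemimodule = record
            { *ₗ-cong      = *ₗ-cong
            ; *ₗ-zeroˡ     = λ x → *ₗ-zeroˡ (proj₁ x)
            ; *ₗ-distribʳ  = λ x a b → *ₗ-distribʳ (proj₁ x) a b
            ; *ₗ-identityˡ = λ x → *ₗ-identityˡ (proj₁ x)
            ; *ₗ-assoc     = λ a b x → *ₗ-assoc a b (proj₁ x)
            ; *ₗ-zeroʳ     = *ₗ-zeroʳ
            ; *ₗ-distribˡ  = λ a x y → *ₗ-distribˡ a (proj₁ x) (proj₁ y)
            }
          }
        ; -ᴹ‿cong    = -ᴹ‿cong
        ; -ᴹ‿inverse = -ᴹ‿inverseˡ ∘ proj₁ , -ᴹ‿inverseʳ ∘ proj₁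
        }
      }
    }
    where
    open Module M
    open Submodule U

  Ker : {M : Module A m₁ ℓ₁} {N : Module A m₂ ℓ₂} → LinearMap M N → Submodule M ℓ₂
  Ker {M = M} {N = N} f = record
    { Member     = λ x → ⟦ x ⟧ N.≈ᴹ N.0ᴹ
    ; resp       = λ x≈y fx≈0 → N.≈ᴹ-trans (⟦⟧-cong (M.≈ᴹ-sym x≈y)) fx≈0
    ; 0-closed   = 0ᴹ-homo
    ; +-closed   = λ {x} {y} fx≈0 fy≈0 → N.≈ᴹ-trans (+ᴹ-homo x y)
        (N.≈ᴹ-trans (N.+ᴹ-cong fx≈0 fy≈0) (N.+ᴹ-identityˡ N.0ᴹ))
    ; neg-closed = λ {x} fx≈0 → N.≈ᴹ-trans (-ᴹ-homo x)
        (N.≈ᴹ-trans (N.-ᴹ‿cong fx≈0) (GroupProperties.ε⁻¹≈ε N.+ᴹ-group))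
    ; *-closed   = λ a {x} fx≈0 → N.≈ᴹ-trans (*ₗ-homo a x)
        (N.≈ᴹ-trans (N.*ₗ-cong (CommutativeRing.refl A) fx≈0) (N.*ₗ-zeroʳ a))
    }
    where
    module M = Module M
    module N = Module N
    open LinearMap f

  ⋂ : {M : Module A m₁ ℓ₁} {I : Set i} → (I → Submodule M p) → Submodule M (i ⊔ p)
  ⋂ U = record
    { Member     = λ x → ∀ j → U.Member j x
    ; resp       = λ x≈y x∈ j → U.resp j x≈y (x∈ j)
    ; 0-closed   = λ j → U.0-closed j
    ; +-closed   = λ x∈ y∈ j → U.+-closed j (x∈ j) (y∈ j)
    ; neg-closed = λ x∈ j → U.neg-closed j (x∈ j)
    ; *-closed   = λ a x∈ j → U.*-closed j a (x∈ j)
    }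
    where module U j = Submodule (U j)

  module _ (M : Module A m₁ ℓ₁) where
    open Module M
    open MonoidSum +ᴹ-monoid using (sum)

    linComb : ∀ {r} → Vector K r → Vector Carrierᴹ r → Carrierᴹ
    linComb a b = sum (λ j → a j *ₗ b j)

    record IsBasis {r} (b : Vector Carrierᴹ r) : Set (c ⊔ ℓ ⊔ m₁ ⊔ ℓ₁) where
      field
        independent : ∀ a → linComb a b ≈ᴹ 0ᴹ → ∀ j → a j ≈ 0#
        spanning    : ∀ x → ∃[ a ] linComb a b ≈ᴹ x

    -- M is free and has a basis of r elements.  When A is nonzero, such an r is
    -- unique, so that this says "rank M = r"; over the zero ring it would hold
    -- for every r.
    HasRank : ℕ → Set (c ⊔ ℓ ⊔ m₁ ⊔ ℓ₁)
    HasRank r = Σ[ b ∈ Vector Carrierᴹ r ] IsBasis b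

------------------------------------------------------------------------
-- Simplicial modules

-- Nondecreasing maps [p] → [q], where [p] = {0,…,p} is Fin (suc p).
Δ : ℕ → ℕ → Set
Δ p q = PosetHomomorphism (≤-poset (suc p)) (≤-poset (suc q))

open PosetHomomorphism public using () renaming (⟦_⟧ to fun)

δ : ∀ {p} → Fin (suc (suc p)) → Δ p (suc p)
δ j = mkPosetHomo _ _ (punchIn j) (λ {x} {y} → punchIn-mono-≤ j x y)

record SimplicialModule (A : CommutativeRing c ℓ) m ℓm
                        : Set (c ⊔ ℓ ⊔ lsuc (m ⊔ ℓm)) where
  field
    X   : ℕ → Module A m ℓm
    act : ∀ {p q} → Δ p q → LinearMap (X q) (X p)

  infixr 8 _·_
  _·_ : ∀ {p q} → Δ p q → Module.Carrierᴹ (X q) → Module.Carrierᴹ (X p)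
  α · x = LinearMap.⟦_⟧ (act α) x

  field
    act-cong : ∀ {p q} {α β : Δ p q} → fun α ≗ fun β →
               ∀ x → Module._≈ᴹ_ (X p) (α · x) (β · x)
    act-id   : ∀ {p} x → Module._≈ᴹ_ (X p) (identity (≤-poset (suc p)) · x) x
    act-∘    : ∀ {p q r} (α : Δ p q) (β : Δ q r) x →
               Module._≈ᴹ_ (X p) (compose α β · x) (α · β · x)

  d : ∀ {p} → Fin (suc (suc p)) → LinearMap (X (suc p)) (X p)
  d j = act (δ j)

  -- The faces d₁, …, d_p out of X_p, with j : Fin p standing for d_{j+1}; there
  -- are none when p = 0.
  d⁺ : ∀ p → Fin p → LinearMap (X p) (X (pred p))
  d⁺ (suc p) j = d (suc j)

  private
    d₀-closed : ∀ p x → Submodule.Member (⋂ (Ker ∘ d⁺ (suc p))) x →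
                Submodule.Member (⋂ (Ker ∘ d⁺ p)) (δ zero · x)
    d₀-closed (suc p) x x∈ j = begin
      δ (suc j) · δ zero · x                  ≈⟨ act-∘ (δ (suc j)) (δ zero) x ⟨
      compose (δ (suc j)) (δ zero) · x        ≈⟨ act-cong (λ _ → ≡.refl) x ⟩
      compose (δ zero) (δ (suc (suc j))) · x  ≈⟨ act-∘ (δ zero) (δ (suc (suc j))) x ⟩
      δ zero · δ (suc (suc j)) · x            ≈⟨ LinearMap.⟦⟧-cong (d zero) (x∈ (suc j)) ⟩
      δ zero · Module.0ᴹ (X (suc p))          ≈⟨ LinearMap.0ᴹ-homo (d zero) ⟩
      Module.0ᴹ (X p)                         ∎
      where open SetoidReasoning (Module.≈ᴹ-setoid (X p))

  -- The normalized (Moore) complex.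
  N : ℕ → Module A (m ⊔ ℓm) ℓm
  N p = ⌊ ⋂ (λ j → Ker (d⁺ p j)) ⌋

  -- N₋ p is N_{p-1}, with N_{-1} = 0.
  N₋ : ℕ → Module A (m ⊔ ℓm) ℓm
  N₋ zero    = Zero.⟨module⟩
  N₋ (suc p) = N p

  ∂ : ∀ p → LinearMap (N p) (N₋ p)
  ∂ zero    = zeroMap (N 0) (N₋ 0)
  ∂ (suc p) = mkLinearMap (N (suc p)) (N p)
    (λ (x , x∈) → δ zero · x , d₀-closed p x x∈)
    (LinearMap.⟦⟧-cong (d zero))
    (λ x y → LinearMap.+ᴹ-homo (d zero) (proj₁ x) (proj₁ y))
    (λ a x → LinearMap.*ₗ-homo (d zero) a (proj₁ x))

  Z : ℕ → Module A (m ⊔ ℓm) ℓm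
  Z p = ⌊ Ker (∂ p) ⌋

------------------------------------------------------------------------
-- The diagonal simplicial tensor module of a constant shape

functionModule : {A : CommutativeRing c ℓ} → Set i → Module A m₁ ℓ₁ → Module A (i ⊔ m₁) (i ⊔ ℓ₁)
functionModule {A = A} I M = record
  { Carrierᴹ = I → Carrierᴹ
  ; _≈ᴹ_     = λ T U → ∀ j → T j ≈ᴹ U j
  ; _+ᴹ_     = λ T U j → T j +ᴹ U j
  ; _*ₗ_     = λ a T j → a *ₗ T j
  ; _*ᵣ_     = λ T a j → a *ₗ T j
  ; 0ᴹ       = λ _ → 0ᴹ
  ; -ᴹ_      = λ T j → -ᴹ T j
  ; isModule = IsModuleFromLeft.isModule {commutativeRing = A} record
    { isLeftModule = record
      { isLeftSemimodule = record
        { +ᴹ-isCommutativeMonoid = Pointwise.isCommutativeMonoid +ᴹ-isCommutativeMonoid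
        ; isPreleftSemimodule = record
          { *ₗ-cong      = λ a≈b T≈U j → *ₗ-cong a≈b (T≈U j)
          ; *ₗ-zeroˡ     = λ T j → *ₗ-zeroˡ (T j)
          ; *ₗ-distribʳ  = λ T a b j → *ₗ-distribʳ (T j) a b
          ; *ₗ-identityˡ = λ T j → *ₗ-identityˡ (T j)
          ; *ₗ-assoc     = λ a b T j → *ₗ-assoc a b (T j)
          ; *ₗ-zeroʳ     = λ a j → *ₗ-zeroʳ a
          ; *ₗ-distribˡ  = λ a T U j → *ₗ-distribˡ a (T j) (U j)
          }
        }
      ; -ᴹ‿cong    = λ T≈U j → -ᴹ‿cong (T≈U j)
      ; -ᴹ‿inverse = (λ T j → -ᴹ‿inverseˡ (T j)) , (λ T j → -ᴹ‿inverseʳ (T j))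
      }
    }
  }
  where
  open Module M
  import Algebra.Construct.Pointwise I as Pointwise

ConstantShape : ∀ {k} → Vec ℕ k → ℕ → Set
ConstantShape s n = ∀ a → lookup s a ≡ suc n

-- For a constant shape s = (n+1,…,n+1) the index set I_p is [p]^k whatever n is,
-- so the module depends on s only through its length k.
diagonalTensorModule : (A : CommutativeRing c ℓ) {k n : ℕ} (s : Vec ℕ k) →
                       ConstantShape s n → SimplicialModule A c ℓ
diagonalTensorModule A {k} s _ = record
  { X        = X
  ; act      = λ {p} {q} α → mkLinearMap (X q) (X p) (λ T → T ∘ map (fun α))
      (λ T≈U → T≈U ∘ map (fun α))
      (λ _ _ _ → refl)
      (λ _ _ _ → refl)
  ; act-cong = λ α≗β T v → reflexive (≡.cong T (map-cong α≗β v))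
  ; act-id   = λ T v → reflexive (≡.cong T (map-id v))
  ; act-∘    = λ α β T v → reflexive (≡.cong T (map-∘ (fun β) (fun α) v))
  }
  where
  open CommutativeRing A using (refl; reflexive)
  X : ℕ → Module A _ _
  X p = functionModule (Vec (Fin (suc p)) k) TensorUnit.⟨module⟩

{-# OPTIONS --safe #-}
-- A function on [p]^k lies in the kernel of d_i iff it vanishes at every tuple
-- that omits the value i.  Hence Z_p consists of the functions supported on the
-- tuples that take all values in [p], and N_p of those supported on the tuples
-- that take all values except possibly 0, and both are free on indicator
-- functions.  What remains is to count surjections: the tail of a surjective
-- tuple with head h takes all values except possibly h, so it is either itself
-- surjective, or surjective onto the complement of h.
module Submission where

open import Defs
open import Algebra.Bundles using (CommutativeRing)
import Algebra.Module.Construct.TensorUnit as TensorUnit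
open import Algebra.Module.Bundles using (Module)
import Algebra.Properties.CommutativeMonoid.Sum as CommutativeMonoidSum
open import Data.Bool.Base using (if_then_else_)
open import Data.Empty using (⊥)
open import Data.Fin.Base using (Fin; zero; suc; punchIn; punchOut)
open import Data.Fin.Permutation using (cast-id)
open import Data.Fin.Properties
  using (_≟_; all?; ¬∀⟶∃¬; 0↔⊥; 1↔⊤; +↔⊎; *↔×; punchIn-injective; punchInᵢ≢i; punchIn-punchOut)
open import Data.Nat.Base using (ℕ; zero; suc; _≤_; _+_; _*_; _!; s≤s)
open import Data.Nat.Properties using (*-zeroʳ)
open import Data.Nat.Tactic.RingSolver using (solve-∀)
open import Data.Product.Base using (Σ-syntax; ∃-syntax; _×_; _,_; proj₁; proj₂)
open import Data.Product.Function.NonDependent.Propositional using (_×-↔_)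
open import Data.Sum.Base using (_⊎_; inj₁; inj₂; [_,_]′)
open import Data.Sum.Function.Propositional using (_⊎-↔_)
open import Data.Unit.Base using (⊤; tt)
open import Data.Vec.Base using (Vec; []; _∷_; map)
open import Data.Vec.Functional using (Vector)
open import Data.Vec.Membership.Propositional using (_∈_; _∉_)
open import Data.Vec.Membership.Propositional.Properties using (∈-map⁺)
import Data.Vec.Membership.DecPropositional as DecMembership
open import Data.Vec.Properties using (∷-injective)
open import Data.Vec.Relation.Unary.Any as Any using (here; there)
open import Data.Vec.Relation.Unary.Any.Properties using (map⁻)
open import Function.Base using (_∘_)
open import Function.Bundles using (_↔_; Inverse)
open import Function.Construct.Composition using (_↔-∘_)
open import Function.Construct.Symmetry using (↔-sym)
open import Level using (Level)
open import Relation.Binary.PropositionalEquality as ≡ using (_≡_; refl; cong; sym; subst)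
import Relation.Binary.Reasoning.Setoid as SetoidReasoning
open import Relation.Nullary.Decidable using (does; yes; no; dec-true; dec-false)
open import Relation.Nullary.Negation using (¬_; contradiction)

private
  variable
    c ℓ m ℓm : Level

-- Free modules

module _ {A : CommutativeRing c ℓ} where
  open CommutativeRing A
    using (_≈_; 0#; 1#; setoid; +-commutativeMonoid; +-cong; +-congˡ; +-identityʳ;
           zeroʳ; *-identityʳ; *-congˡ; reflexive)
    renaming (Carrier to K; _+_ to _+ᴬ_; _*_ to _*ᴬ_; trans to ≈-trans)
  open CommutativeMonoidSum +-commutativeMonoid
    using (sum; sum-cong-≋; sum-remove; sum-replicate-zero)

  kronecker : ∀ {r} → Fin r → Fin r → K
  kronecker i j = if does (i ≟ j) then 1# else 0#

  sum-kronecker : ∀ {r} (a : Vector K r) i → sum (λ j → a j *ᴬ kronecker i j) ≈ a i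
  sum-kronecker {suc r} a i = begin
    sum t                               ≈⟨ sum-remove {i = i} t ⟩
    t i +ᴬ sum (λ j → t (punchIn i j))  ≈⟨ +-cong diagonal (sum-cong-≋ off-diagonal) ⟩
    a i +ᴬ sum {r} (λ _ → 0#)           ≈⟨ +-congˡ (sum-replicate-zero r) ⟩
    a i +ᴬ 0#                           ≈⟨ +-identityʳ (a i) ⟩
    a i                                 ∎
    where
    open SetoidReasoning setoid
    t : Vector K (suc r)
    t j = a j *ᴬ kronecker i j
    diagonal : t i ≈ a i
    diagonal rewrite dec-true (i ≟ i) refl = *-identityʳ (a i)
    off-diagonal : ∀ j → t (punchIn i j) ≈ 0#
    off-diagonal j rewrite dec-false (i ≟ punchIn i j) (punchInᵢ≢i i j ∘ sym) =
      zeroʳ (a (punchIn i j))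

  module _ {M : Module A m ℓm} {C : Set}
           (f : LinearMap M (functionModule C TensorUnit.⟨module⟩)) where
    open Module M
    open LinearMap f

    linComb-homo : ∀ {r} (a : Vector K r) (b : Vector Carrierᴹ r) x →
                   ⟦ linComb M a b ⟧ x ≈ sum (λ j → a j *ᴬ ⟦ b j ⟧ x)
    linComb-homo {zero}  a b x = 0ᴹ-homo x
    linComb-homo {suc r} a b x = ≈-trans (+ᴹ-homo _ _ x)
      (+-cong (*ₗ-homo (a zero) (b zero) x) (linComb-homo (a ∘ suc) (b ∘ suc) x))

    -- The basis consists of preimages of the indicator functions of the points of `C`. Evaluating a
    -- linear combination at a point recovers one coefficient, whence independence; by injectivity,
    -- the values of `⟦ x ⟧` serve as the coordinates of `x`, whence spanning.
    isomorphism⇒rank : ∀ {r} → C ↔ Fin r →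
      (∀ {x y} → (∀ i → ⟦ x ⟧ i ≈ ⟦ y ⟧ i) → x ≈ᴹ y) →
      (∀ (T : C → K) → ∃[ x ] (∀ i → ⟦ x ⟧ i ≈ T i)) →
      HasRank M r
    isomorphism⇒rank {r} C↔r injective surjective = b , record
      { independent = λ a ab≈0 j → begin
          a j                         ≡⟨ cong a (strictlyInverseˡ j) ⟨
          a (to (from j))             ≈⟨ coordinate a (from j) ⟨
          ⟦ linComb M a b ⟧ (from j)  ≈⟨ ⟦⟧-cong ab≈0 (from j) ⟩
          ⟦ 0ᴹ ⟧ (from j)             ≈⟨ 0ᴹ-homo (from j) ⟩
          0#                          ∎
      ; spanning = λ x → ⟦ x ⟧ ∘ from , injective (λ i →
          ≈-trans (coordinate (⟦ x ⟧ ∘ from) i)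
                  (reflexive (cong ⟦ x ⟧ (strictlyInverseʳ i))))
      }
      where
      open Inverse C↔r
      open SetoidReasoning setoid
      b : Vector Carrierᴹ r
      b j = proj₁ (surjective (λ i → kronecker (to i) j))
      coordinate : ∀ a i → ⟦ linComb M a b ⟧ i ≈ a (to i)
      coordinate a i = begin
        ⟦ linComb M a b ⟧ i                      ≈⟨ linComb-homo a b i ⟩
        sum (λ j → a j *ᴬ ⟦ b j ⟧ i)             ≈⟨ sum-cong-≋ {r} (λ j → *-congˡ (proj₂ (surjective _) i)) ⟩
        sum (λ j → a j *ᴬ kronecker (to i) j)    ≈⟨ sum-kronecker a (to i) ⟩
        a (to i)                                 ∎

-- Tuples omitting a value

∉-map-punchIn : ∀ {k m} i (w : Vec (Fin m) k) → i ∉ map (punchIn i) w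
∉-map-punchIn i w i∈ with Any.satisfied (map⁻ i∈)
... | j , i≡ = punchInᵢ≢i i j (sym i≡)

∈-map-punchIn⁻ : ∀ {k m} i {j} {w : Vec (Fin m) k} → punchIn i j ∈ map (punchIn i) w → j ∈ w
∈-map-punchIn⁻ i {j} = Any.map (punchIn-injective i j _) ∘ map⁻

map-punchIn-injective : ∀ {k m} i {v w : Vec (Fin m) k} →
                        map (punchIn i) v ≡ map (punchIn i) w → v ≡ w
map-punchIn-injective i {[]}    {[]}    _  = refl
map-punchIn-injective i {x ∷ v} {y ∷ w} eq with ∷-injective eq
... | x≡y , v≡w = ≡.cong₂ _∷_ (punchIn-injective i x y x≡y) (map-punchIn-injective i v≡w)

∉⇒map-punchIn : ∀ {k m} {i : Fin (suc m)} {v : Vec (Fin (suc m)) k} → i ∉ v →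
                ∃[ w ] map (punchIn i) w ≡ v
∉⇒map-punchIn {v = []}    i∉ = [] , refl
∉⇒map-punchIn {v = x ∷ v} i∉ with ∉⇒map-punchIn (i∉ ∘ there)
... | w , eq = punchOut (i∉ ∘ here) ∷ w , ≡.cong₂ _∷_ (punchIn-punchOut (i∉ ∘ here)) eq

-- Enumeration of the surjective tuples

-- Codes for the `k`-tuples that take all of `m` values, built from sums and products so that they
-- can be counted directly. `OntoExcept k m` codes the tuples over `m + 1` values that may miss only
-- a distinguished value `h`: the left summand if `h` is missed, the right one if it is taken. The
-- codes do not depend on `h`; it enters only on decoding.
Onto : ℕ → ℕ → Set
OntoExcept : ℕ → ℕ → Set

Onto zero    zero    = ⊤
Onto zero    (suc m) = ⊥
Onto (suc k) zero    = ⊥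
Onto (suc k) (suc m) = Fin (suc m) × OntoExcept k m

OntoExcept k m = Onto k m ⊎ Onto k (suc m)

tuple : ∀ k m → Onto k m → Vec (Fin m) k
tupleExcept : ∀ k m → Fin (suc m) → OntoExcept k m → Vec (Fin (suc m)) k

tuple zero    zero    _       = []
tuple (suc k) (suc m) (h , x) = h ∷ tupleExcept k m h x

tupleExcept k m h (inj₁ x) = map (punchIn h) (tuple k m x)
tupleExcept k m h (inj₂ x) = tuple k (suc m) x

∈-tuple : ∀ k m x i → i ∈ tuple k m x
∈-tupleExcept : ∀ k m h x j → punchIn h j ∈ tupleExcept k m h x

∈-tuple zero    zero    _       ()
∈-tuple (suc k) (suc m) (h , x) i with h ≟ i
... | yes h≡i = here (sym h≡i)
... | no  h≢i = there (subst (_∈ _) (punchIn-punchOut h≢i) (∈-tupleExcept k m h x (punchOut h≢i)))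

∈-tupleExcept k m h (inj₁ x) j = ∈-map⁺ (punchIn h) (∈-tuple k m x j)
∈-tupleExcept k m h (inj₂ x) j = ∈-tuple k (suc m) x (punchIn h j)

tuple-injective : ∀ k m {x y} → tuple k m x ≡ tuple k m y → x ≡ y
tupleExcept-injective : ∀ k m h {x y} → tupleExcept k m h x ≡ tupleExcept k m h y → x ≡ y

tuple-injective zero    zero    _  = refl
tuple-injective (suc k) (suc m) {h , x} {h′ , y} eq with ∷-injective eq
... | refl , eq′ = cong (h ,_) (tupleExcept-injective k m h eq′)

tupleExcept-injective k m h {inj₁ x} {inj₁ y} eq =
  cong inj₁ (tuple-injective k m (map-punchIn-injective h eq))
-- The two summands decode to different tuples, because `h` occurs only in those from the right one.
tupleExcept-injective k m h {inj₁ x} {inj₂ y} eq =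
  contradiction (subst (h ∈_) (sym eq) (∈-tuple k (suc m) y h)) (∉-map-punchIn h _)
tupleExcept-injective k m h {inj₂ x} {inj₁ y} eq =
  contradiction (subst (h ∈_) eq (∈-tuple k (suc m) x h)) (∉-map-punchIn h _)
tupleExcept-injective k m h {inj₂ x} {inj₂ y} eq = cong inj₂ (tuple-injective k (suc m) eq)

module _ {m : ℕ} where
  open DecMembership (_≟_ {m}) public using (_∈?_)

-- Mutual induction. A tail that contains the head `h` again is itself surjective; otherwise it
-- factors through `punchIn h` as a surjective tuple over one value fewer.
tuple-surjective : ∀ k m v → (∀ i → i ∈ v) → ∃[ x ] tuple k m x ≡ v
tupleExcept-surjective : ∀ k m h v → (∀ j → punchIn h j ∈ v) → ∃[ x ] tupleExcept k m h x ≡ v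

tuple-surjective zero    zero    []      _  = tt , refl
tuple-surjective zero    (suc m) []      i∈ with () ← i∈ zero
tuple-surjective (suc k) (suc m) (h ∷ v) i∈
  -- A value other than `h` cannot occur at the head, so it occurs in the tail.
  with tupleExcept-surjective k m h v (λ j → Any.tail (punchInᵢ≢i h j) (i∈ (punchIn h j)))
... | x , eq = (h , x) , cong (h ∷_) eq

tupleExcept-surjective k m h v j∈ with h ∈? v
... | yes h∈v with tuple-surjective k (suc m) v all∈
  where
  all∈ : ∀ i → i ∈ v
  all∈ i with h ≟ i
  ... | yes refl = h∈v
  ... | no  h≢i  = subst (_∈ v) (punchIn-punchOut h≢i) (j∈ (punchOut h≢i))
...   | x , eq = inj₂ x , eq
tupleExcept-surjective k m h v j∈ | no h∉v with ∉⇒map-punchIn h∉v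
... | w , refl with tuple-surjective k m w (∈-map-punchIn⁻ h ∘ j∈)
...   | x , refl = inj₁ x , refl

-- A finite search over the values makes this dichotomy constructive and produces the omitted value,
-- which later selects a face.
tuple-or-omits : ∀ k m v → (∃[ x ] tuple k m x ≡ v) ⊎ (∃[ i ] i ∉ v)
tuple-or-omits k m v with all? (_∈? v)
... | yes i∈ = inj₁ (tuple-surjective k m v i∈)
... | no  ¬i∈ = inj₂ (¬∀⟶∃¬ m _ (_∈? v) ¬i∈)

tupleExcept-or-omits : ∀ k m h v →
                       (∃[ x ] tupleExcept k m h x ≡ v) ⊎ (∃[ j ] punchIn h j ∉ v)
tupleExcept-or-omits k m h v with all? (λ j → punchIn h j ∈? v)
... | yes j∈ = inj₁ (tupleExcept-surjective k m h v j∈)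
... | no  ¬j∈ = inj₂ (¬∀⟶∃¬ m _ (λ j → punchIn h j ∈? v) ¬j∈)

-- The recursion of `Onto` is that of `S` multiplied by the factorial: the choice of the head
-- supplies the factor `suc m` that turns `m !` into `suc m !`.
Onto↔Fin : ∀ k m → Onto k m ↔ Fin (m ! * S k m)
OntoExcept↔Fin : ∀ k m → OntoExcept k m ↔ Fin (m ! * S k m + suc m ! * S k (suc m))

Onto↔Fin zero    zero    = ↔-sym 1↔⊤
Onto↔Fin zero    (suc m) = cast-id (sym (*-zeroʳ (suc m !))) ↔-∘ ↔-sym 0↔⊥
Onto↔Fin (suc k) zero    = ↔-sym 0↔⊥
Onto↔Fin (suc k) (suc m) =
  cast-id (rearrange m (m !) (S k m) (S k (suc m))) ↔-∘
  (↔-sym *↔× ↔-∘ (cast-id refl ×-↔ OntoExcept↔Fin k m))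
  where
  rearrange : ∀ m f s t → suc m * (f * s + (suc m * f) * t) ≡ (suc m * f) * (s + suc m * t)
  rearrange = solve-∀

OntoExcept↔Fin k m = ↔-sym +↔⊎ ↔-∘ (Onto↔Fin k m ⊎-↔ Onto↔Fin k (suc m))

-- Modules of functions with prescribed support

module _ {A : CommutativeRing c ℓ} where
  open CommutativeRing A
    using (_≈_; 0#; reflexive) renaming (Carrier to K; refl to ≈-refl; sym to ≈-sym; trans to ≈-trans)

  module _ {I C J : Set} (e : C → I) (Off : J → I → Set)
           (injective : ∀ {x y} → e x ≡ e y → x ≡ y)
           (off-image : ∀ x j → ¬ Off j (e x))
           (image-or-off : ∀ v → (∃[ x ] e x ≡ v) ⊎ (∃[ j ] Off j v)) where

    -- Here `e` enumerates the permitted support, and `Off j v` is the `j`-th reason for a function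
    -- to vanish at `v`; for the Moore complex, the reason is that `v` omits a certain value.
    VanishesOff : (I → K) → Set ℓ
    VanishesOff T = ∀ {j v} → Off j v → T v ≈ 0#

    extend : (C → K) → I → K
    extend T v = [ T ∘ proj₁ , (λ _ → 0#) ]′ (image-or-off v)

    extend-image : ∀ T x → extend T (e x) ≈ T x
    extend-image T x with image-or-off (e x)
    ... | inj₁ (y , eq)  = reflexive (cong T (injective eq))
    ... | inj₂ (j , off) = contradiction off (off-image x j)

    extend-off : ∀ T → VanishesOff (extend T)
    extend-off T {j} {v} off with image-or-off v
    ... | inj₁ (y , refl) = contradiction off (off-image y j)
    ... | inj₂ _          = ≈-refl

    determined-on-image : ∀ {T U} → VanishesOff T → VanishesOff U →
                          (∀ x → T (e x) ≈ U (e x)) → ∀ v → T v ≈ U v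
    determined-on-image T-off U-off T≈U v with image-or-off v
    ... | inj₁ (x , refl) = T≈U x
    ... | inj₂ (_ , off)  = ≈-trans (T-off off) (≈-sym (U-off off))

    module _ {M : Module A m ℓm} (f : LinearMap M (functionModule I TensorUnit.⟨module⟩)) where
      open Module M
      open LinearMap f

      -- Restriction along `e` identifies `M` with all functions on `C`; extension by zero provides
      -- the preimages.
      supported⇒rank : ∀ {r} → C ↔ Fin r →
        (∀ {x y} → (∀ v → ⟦ x ⟧ v ≈ ⟦ y ⟧ v) → x ≈ᴹ y) →
        (∀ x → VanishesOff ⟦ x ⟧) →
        (∀ T → VanishesOff T → ∃[ x ] (∀ v → ⟦ x ⟧ v ≈ T v)) →
        HasRank M r
      supported⇒rank C↔r f-injective vanishes surjective = isomorphism⇒rank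
        (mkLinearMap M (functionModule C TensorUnit.⟨module⟩) (λ x → ⟦ x ⟧ ∘ e)
          (λ x≈y → ⟦⟧-cong x≈y ∘ e) (λ x y → +ᴹ-homo x y ∘ e) (λ a x → *ₗ-homo a x ∘ e))
        C↔r
        (λ {x} {y} x≈y → f-injective (determined-on-image (vanishes x) (vanishes y) x≈y))
        (λ T → let x , x≈ = surjective (extend T) (extend-off T) in
               x , λ i → ≈-trans (x≈ (e i)) (extend-image T i))

-- The Moore complex and its cycles

module _ (A : CommutativeRing c ℓ) {k n : ℕ} (s : Vec ℕ k) (const : ConstantShape s n) where
  open CommutativeRing A using (_≈_; 0#) renaming (Carrier to K; refl to ≈-refl)
  open SimplicialModule (diagonalTensorModule A s const)

  -- A tuple omitting `i` has the form `map (punchIn i) w`, and the value of `T` there is the value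
  -- of its `i`-th face at `w`.
  ker-d⇒vanishes : ∀ {p i} {T : Vec (Fin (suc (suc p))) k → K} →
    (∀ w → T (map (punchIn i) w) ≈ 0#) → ∀ {v} → i ∉ v → T v ≈ 0#
  ker-d⇒vanishes dT≈0 i∉v with ∉⇒map-punchIn i∉v
  ... | w , refl = dT≈0 w

  N-vanishes : ∀ p (x : Module.Carrierᴹ (N p)) {j v} → suc j ∉ v → proj₁ x v ≈ 0#
  -- In degree 0 there is no `j`, matching the absence of faces.
  N-vanishes (suc p) (T , T∈) {j} = ker-d⇒vanishes {T = T} (T∈ j)

  N-member : ∀ p (T : Vec (Fin (suc p)) k → K) → (∀ {j v} → suc j ∉ v → T v ≈ 0#) →
             Σ[ x ∈ Module.Carrierᴹ (N p) ] (∀ v → proj₁ x v ≈ T v)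
  N-member zero    T T-off = (T , λ ()) , λ _ → ≈-refl
  N-member (suc p) T T-off =
    (T , λ j w → T-off (∉-map-punchIn (suc j) w)) , λ _ → ≈-refl

  -- Degree 0 is where `1 ≤ k` enters: all of `X 0` consists of cycles, so the claim holds only
  -- because a nonempty tuple over the single value 0 cannot omit it. For `k = 0` the empty tuple
  -- would.
  Z-vanishes : 1 ≤ k → ∀ p (x : Module.Carrierᴹ (Z p)) {i v} → i ∉ v → proj₁ (proj₁ x) v ≈ 0#
  Z-vanishes (s≤s _) zero    _             {zero}  {zero ∷ _} i∉ = contradiction (here refl) i∉
  Z-vanishes _       (suc p) (x , d₀x≈0)   {zero}  = ker-d⇒vanishes {T = proj₁ x} d₀x≈0
  Z-vanishes _       (suc p) (x , _)       {suc j} = N-vanishes (suc p) x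

  Z-member : ∀ p (T : Vec (Fin (suc p)) k → K) → (∀ {i v} → i ∉ v → T v ≈ 0#) →
             Σ[ x ∈ Module.Carrierᴹ (Z p) ] (∀ v → proj₁ (proj₁ x) v ≈ T v)
  -- The differential out of degree 0 is the zero map, so its kernel condition is trivial.
  Z-member zero    T T-off = ((T , λ ()) , _) , λ _ → ≈-refl
  Z-member (suc p) T T-off =
    ((T , λ j w → T-off (∉-map-punchIn (suc j) w)) , λ w → T-off (∉-map-punchIn zero w)) ,
    λ _ → ≈-refl

  rank-N : ∀ p → HasRank (N p) (p ! * S k p + suc p ! * S k (suc p))
  -- The distinguished value is 0, whose face is not among those defining `N`; `punchIn zero j` is
  -- `suc j`, the index of the remaining faces.
  rank-N p = supported⇒rank (tupleExcept k p zero) (λ j v → suc j ∉ v)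
    (tupleExcept-injective k p zero)
    (λ x j j∉ → j∉ (∈-tupleExcept k p zero x j))
    (tupleExcept-or-omits k p zero)
    (mkLinearMap (N p) (X p) proj₁ (λ x≈y → x≈y) (λ _ _ _ → ≈-refl) (λ _ _ _ → ≈-refl))
    (OntoExcept↔Fin k p) (λ x≈y → x≈y) (N-vanishes p) (N-member p)

  rank-Z : 1 ≤ k → ∀ p → HasRank (Z p) (suc p ! * S k (suc p))
  -- The set [p] has `suc p` values, and now each of them must be taken.
  rank-Z 1≤k p = supported⇒rank (tuple k (suc p)) (λ i v → i ∉ v)
    (tuple-injective k (suc p))
    (λ x i i∉ → i∉ (∈-tuple k (suc p) x i))
    (tuple-or-omits k (suc p))
    (mkLinearMap (Z p) (X p) (proj₁ ∘ proj₁) (λ x≈y → x≈y) (λ _ _ _ → ≈-refl) (λ _ _ _ → ≈-refl))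
    (Onto↔Fin k (suc p)) (λ x≈y → x≈y) (Z-vanishes 1≤k p) (Z-member p)

theorem5p6 : ∀ {c ℓ} (A : CommutativeRing c ℓ) → Nonzero A →
    (k n : ℕ) → 1 ≤ k →
    (s : Vec ℕ k) (const : ConstantShape s n) (p : ℕ) →
    HasRank (SimplicialModule.Z (diagonalTensorModule A s const) p)
    ((suc p) ! * S k (suc p)) ×
    HasRank (SimplicialModule.N (diagonalTensorModule A s const) p)
    (p ! * S k p + (suc p) ! * S k (suc p))
theorem5p6 A _ k n 1≤k s const p = rank-Z A s const 1≤k p , rank-N A s const p
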